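{- Let $t$ and $m$ be positive integers. Then there exist a constant $c>0$ and $X_0$ (depending on $m,t$) such that for all $X\ge X_0$, \[ \#\left\{ n\leq X : p_{mt,t}(n)\equiv 0\pmod{2} \right\} \geq c\sqrt{X/3}, \] i.e. $\#\{ n\leq X : p_{mt,t}(n)\equiv 0\pmod{2}\} \gg \sqrt{X/3}$ for large $X$.
   Context: A partition $\lambda$ of a non-negative integer $n$ is a non-increasing sequence of positive integers (its parts) summing to $n$. For positive integers $A$ and $a$, $\mathrm{mex}_{A,a}(\lambda)$ denotes the smallest positive integer congruent to $a$ modulo $A$ that is not a part of $\lambda$. Then $p_{A,a}(n)$ denotes the number of partitions $\lambda$ of $n$ satisfying $\mathrm{mex}_{A,a}(\lambda)\equiv a \pmod{2A}$. Here $n$ ranges over positive integers. -}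

module Defs where

open import Data.Nat.Base
  using (ℕ; zero; suc; _+_; _*_; _≤_; _<_; z≤n; s≤s; ∣_-_∣; NonZero; >-nonZero⁻¹)
open import Data.Nat.Properties
  using ( _≟_; _<?_; _≥?_; ≤-trans; ≤-<-trans; <⇒≱; m≤n⇒m<n∨m≡n; m≤m+n; m≤n+m; m≤n*m
        ; m<n+m; +-mono-≤; +-suc; +-identityʳ; ∣-∣-comm; ∣m-m+n∣≡n)
open import Data.Nat.Divisibility using (_∣_; _∣?_; m∣m*n)
open import Data.Nat.ListAction using (sum)
open import Data.Integer.Base as ℤ using (0ℤ)
open import Data.Rational.Base as ℚ using (ℚ; 0ℚ; floor)
open import Data.List.Base
  using (List; []; _∷_; filter; length; upTo; applyUpTo; cartesianProductWith)
open import Data.List.Properties using (∷-injective)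
open import Data.List.Membership.Propositional using (_∈_; _∉_)
open import Data.List.Membership.Propositional.Properties
  using (∈-filter⁺; ∈-filter⁻; ∈-upTo⁺; ∈-cartesianProductWith⁺; ∈-cartesianProductWith⁻)
open import Data.List.Membership.DecPropositional _≟_ using (_∉?_)
open import Data.List.Relation.Unary.All as All using (All; []; _∷_)
open import Data.List.Relation.Unary.Any using (here; there)
open import Data.List.Relation.Unary.Linked using (Linked; linked?)
open import Data.List.Relation.Unary.Unique.Propositional using (Unique; []; _∷_)
open import Data.List.Relation.Unary.Unique.Propositional.Properties
  using (upTo⁺; filter⁺; cartesianProductWith⁺)
open import Data.Product.Base using (_×_; _,_; proj₂)
open import Data.Sum.Base using (inj₁; inj₂)
open import Relation.Nullary using (Dec; yes; no; ¬_; contradiction; _×-dec_)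
open import Relation.Unary using (Pred; Decidable)
open import Relation.Binary.PropositionalEquality
  using (_≡_; refl; sym; trans; subst)
open import Level using (0ℓ)

infix 4 _≡_[mod_] _≡?_[mod_]

_≡_[mod_] : ℕ → ℕ → ℕ → Set
x ≡ y [mod k ] = k ∣ ∣ x - y ∣

_≡?_[mod_] : ∀ x y k → Dec (x ≡ y [mod k ])
x ≡? y [mod k ] = k ∣? ∣ x - y ∣

IsPartition : ℕ → List ℕ → Set
IsPartition n λs =
  All (0 <_) λs × Linked (λ x y → y ≤ x) λs × sum λs ≡ n

isPartition? : ∀ n → Decidable (IsPartition n)
isPartition? n λs =
  All.all? (0 <?_) λs ×-dec linked? _≥?_ λs ×-dec (sum λs ≟ n)

-- All lists of length at most l with entries at most b, each listed once.
words : ℕ → ℕ → List (List ℕ)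
words b zero    = [] ∷ []
words b (suc l) = [] ∷ cartesianProductWith _∷_ (upTo (suc b)) (words b l)

-- A partition of n has at most n parts, each at most n, so nothing is missed
-- (∈-partitions below) and nothing is listed twice (partitions-unique below).
partitions : ℕ → List (List ℕ)
partitions n = filter (isPartition? n) (words n n)

IsLeast : Pred ℕ 0ℓ → ℕ → Set
IsLeast P x = P x × (∀ y → P y → x ≤ y)

MissingTerm : ℕ → ℕ → List ℕ → Pred ℕ 0ℓ
MissingTerm A a λs x = 0 < x × x ≡ a [mod A ] × x ∉ λs

missingTerm? : ∀ A a λs → Decidable (MissingTerm A a λs)
missingTerm? A a λs x = (0 <? x) ×-dec (x ≡? a [mod A ]) ×-dec (x ∉? λs)

leastFrom : {P : Pred ℕ 0ℓ} → Decidable P → (fuel start : ℕ) → ℕ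
leastFrom P? zero    i = i
leastFrom P? (suc f) i with P? i
... | yes _ = i
... | no  _ = leastFrom P? f (suc i)

-- The search bound suffices: a + A * sum λs exceeds every part (mex-isLeast below).
mex : ℕ → ℕ → List ℕ → ℕ
mex A a λs = leastFrom (missingTerm? A a λs) (a + A * sum λs) 0

p : ℕ → ℕ → ℕ → ℕ
p A a n = length (filter (λ λs → mex A a λs ≡? a [mod 2 * A ]) (partitions n))

-- #{ 1 ≤ n ≤ X : p A a n ≡ 0 (mod 2) }.
evenCount : ℕ → ℕ → ℚ → ℕ
evenCount A a X =
  length (filter (λ n → p A a n ≡? 0 [mod 2 ]) (applyUpTo suc ℤ.∣ floor X ℤ.⊔ 0ℤ ∣))

fromℕ : ℕ → ℚ
fromℕ n = ℤ.+ n ℚ./ 1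

infix 4 _*√_≤_

-- c * √x ≤ y for c, x ≥ 0, where √x is the supremum of the rationals s ≥ 0
-- with s² ≤ x.
_*√_≤_ : ℚ → ℚ → ℚ → Set
c *√ x ≤ y = ∀ s → 0ℚ ℚ.≤ s → s ℚ.* s ℚ.≤ x → c ℚ.* s ℚ.≤ y

private
  part≤sum : ∀ {x} {xs : List ℕ} → x ∈ xs → x ≤ sum xs
  part≤sum {xs = x ∷ xs} (here refl) = m≤m+n x (sum xs)
  part≤sum {xs = x ∷ xs} (there x∈) = ≤-trans (part≤sum x∈) (m≤n+m (sum xs) x)

  ∈-words : ∀ b l {xs} → All (_≤ b) xs → length xs ≤ l → xs ∈ words b l
  ∈-words b zero    []         _         = here refl
  ∈-words b (suc l) []         _         = here refl
  ∈-words b (suc l) (x≤b ∷ ps) (s≤s len) =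
    there (∈-cartesianProductWith⁺ _∷_ (∈-upTo⁺ (s≤s x≤b)) (∈-words b l ps len))

  words-unique : ∀ b l → Unique (words b l)
  words-unique b zero    = [] ∷ []
  words-unique b (suc l) =
    All.tabulate nonempty
      ∷ cartesianProductWith⁺ _∷_ ∷-injective (upTo⁺ (suc b)) (words-unique b l)
    where
    nonempty : ∀ {ys} → ys ∈ cartesianProductWith _∷_ (upTo (suc b)) (words b l) → ¬ [] ≡ ys
    nonempty ys∈ refl with ∈-cartesianProductWith⁻ _∷_ (upTo (suc b)) (words b l) ys∈
    ... | _ , _ , _ , _ , ()

  length≤sum : ∀ {xs} → All (0 <_) xs → length xs ≤ sum xs
  length≤sum []       = z≤n
  length≤sum (q ∷ qs) = +-mono-≤ q (length≤sum qs)

  leastFrom-isLeast : ∀ {P : Pred ℕ 0ℓ} (P? : Decidable P) f i →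
                      (∀ y → P y → i ≤ y) → P (f + i) → IsLeast P (leastFrom P? f i)
  leastFrom-isLeast P? zero    i lb Pi = Pi , lb
  leastFrom-isLeast {P} P? (suc f) i lb Pf with P? i
  ... | yes Pi = Pi , lb
  ... | no ¬Pi = leastFrom-isLeast P? f (suc i) lb′ (subst P (sym (+-suc f i)) Pf)
    where
    lb′ : ∀ y → P y → suc i ≤ y
    lb′ y Py with m≤n⇒m<n∨m≡n (lb y Py)
    ... | inj₁ i<y  = i<y
    ... | inj₂ refl = contradiction Py ¬Pi

∈-partitions : ∀ {n λs} → IsPartition n λs → λs ∈ partitions n
∈-partitions {n} {λs} pλ@(pos , _ , refl) =
  ∈-filter⁺ (isPartition? n) (∈-words n n (All.tabulate part≤sum) (length≤sum pos)) pλ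

∈-partitions⁻ : ∀ {n λs} → λs ∈ partitions n → IsPartition n λs
∈-partitions⁻ {n} λs∈ = proj₂ (∈-filter⁻ (isPartition? n) {xs = words n n} λs∈)

partitions-unique : ∀ n → Unique (partitions n)
partitions-unique n = filter⁺ (isPartition? n) (words-unique n n)

mex-isLeast : ∀ A a .{{_ : NonZero A}} .{{_ : NonZero a}} λs →
              IsLeast (MissingTerm A a λs) (mex A a λs)
mex-isLeast A a λs =
  leastFrom-isLeast (missingTerm? A a λs) bound 0 (λ _ _ → z≤n)
    (subst (MissingTerm A a λs) (sym (+-identityʳ bound)) (0<bound , bound≡a , bound∉λs))
  where
  bound = a + A * sum λs

  sum<bound : sum λs < bound
  sum<bound = ≤-<-trans (m≤n*m (sum λs) A) (m<n+m (A * sum λs) (>-nonZero⁻¹ a))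

  0<bound : 0 < bound
  0<bound = ≤-<-trans z≤n sum<bound

  bound≡a : bound ≡ a [mod A ]
  bound≡a = subst (A ∣_) (sym (trans (∣-∣-comm bound a) (∣m-m+n∣≡n a _))) (m∣m*n (sum λs))

  bound∉λs : bound ∉ λs
  bound∉λs b∈ = <⇒≱ sum<bound (part≤sum b∈)

{-# OPTIONS --safe #-}
-- Let a = t, A = m t and T_k = a + (a + A) + … + (a + (k - 1) A).  If mex(λ) = a + κ A,
-- then a, a + A, …, a + (k - 1) A are all parts of λ exactly for k = 0, …, κ, so modulo 2
-- the indicator of κ being even is the number of such k, and p_{A,a}(n) ≡ ∑_k P(n - T_k),
-- where P is the partition function.  Euler's recurrence ∑_j P(n - j (3 j + 1) / 2) ≡ [n = 0],
-- obtained from Shanks' finite form of the pentagonal number theorem, then gives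
-- ∑_j p_{A,a}(n - j (3 j + 1) / 2) ≡ 0 unless n is some T_k.  If moreover the number of
-- pentagonal numbers ≤ n is odd, one of the summands has to be even.  Below
-- K (3 K - 1) / 2 there are K² such n and at most 2 K of the T_k, and each even value is
-- reached from at most 2 K - 1 of the n; so there are at least about K / 2 even values.
module Submission where

open import Defs

-- Power series over the field with two elements.

module Series where
  open import Data.Nat.Base using (ℕ; zero; suc; _+_; _*_; _≤_; _<_; _∸_; z≤n; s≤s)
  open import Data.Nat.Properties
  open import Data.Nat.Tactic.RingSolver using (solve-∀)
  open import Data.Parity.Base as ℙ using (Parity; 0ℙ)
  import Data.Parity.Properties as ℙ
  open import Algebra.Properties.CommutativeSemigroup ℙ.+-commutativeSemigroup using (interchange)
  open import Data.List.Base using (List; []; _∷_)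
  open import Relation.Binary.PropositionalEquality

  -- Power series over 𝔽₂, as coefficient sequences; shift d is multiplication by q^d.
  Series : Set
  Series = ℕ → Parity

  infixl 6 _⊕_

  _⊕_ : Series → Series → Series
  (f ⊕ g) n = f n ℙ.+ g n

  shift : ℕ → Series → Series
  shift zero    f n       = f n
  shift (suc d) f zero    = 0ℙ
  shift (suc d) f (suc n) = shift d f n

  shift-⊕ : ∀ d f g → shift d (f ⊕ g) ≗ shift d f ⊕ shift d g
  shift-⊕ zero    f g n       = refl
  shift-⊕ (suc d) f g zero    = refl
  shift-⊕ (suc d) f g (suc n) = shift-⊕ d f g n

  shift-shift : ∀ d e f → shift d (shift e f) ≗ shift (d + e) f
  shift-shift zero    e f n       = refl
  shift-shift (suc d) e f zero    = refl
  shift-shift (suc d) e f (suc n) = shift-shift d e f n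

  shift-local : ∀ d {f g} n → (∀ i → i ≤ n → f i ≡ g i) → shift d f n ≡ shift d g n
  shift-local zero    n       f≡g = f≡g n ≤-refl
  shift-local (suc d) zero    f≡g = refl
  shift-local (suc d) (suc n) f≡g = shift-local d n (λ i i≤n → f≡g i (m≤n⇒m≤1+n i≤n))

  shift-cong : ∀ d {f g} → f ≗ g → shift d f ≗ shift d g
  shift-cong d f≗g n = shift-local d n (λ i _ → f≗g i)

  shift-comm : ∀ d e f → shift d (shift e f) ≗ shift e (shift d f)
  shift-comm d e f n rewrite shift-shift d e f n | shift-shift e d f n | +-comm d e = refl

  shift-+ : ∀ d f n → shift d f (d + n) ≡ f n
  shift-+ zero    f n = refl
  shift-+ (suc d) f n = shift-+ d f n

  shift-∸ : ∀ {d n} f → d ≤ n → shift d f n ≡ f (n ∸ d)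
  shift-∸ f z≤n       = refl
  shift-∸ f (s≤s d≤n) = shift-∸ f d≤n

  shift-< : ∀ {d n} f → n < d → shift d f n ≡ 0ℙ
  shift-< {n = zero}  f (s≤s _)   = refl
  shift-< {n = suc n} f (s≤s n<d) = shift-< f n<d

  -- Multiplication by 1 - q^d, which is 1 + q^d modulo 2.
  δ : ℕ → Series → Series
  δ d f = f ⊕ shift d f

  δ-cong : ∀ d {f g} → f ≗ g → δ d f ≗ δ d g
  δ-cong d f≗g n = cong₂ ℙ._+_ (f≗g n) (shift-cong d f≗g n)

  δ-comm : ∀ d e f → δ d (δ e f) ≗ δ e (δ d f)
  δ-comm d e f n
    rewrite shift-⊕ d f (shift e f) n | shift-⊕ e f (shift d f) n | shift-comm d e f n =
    interchange (f n) (shift e f n) (shift d f n) (shift e (shift d f) n)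

  -- Multiplication by ∏ (1 - q^i) over k < i ≤ k + d.
  ∏δ : (k d : ℕ) → Series → Series
  ∏δ k zero    f = f
  ∏δ k (suc d) f = δ (suc k + d) (∏δ k d f)

  -- `∏δ` grows at the top; commuting its lowest factor outwards allows summands with neighbouring
  -- `k` to be compared.
  ∏δ-bottom : ∀ k d f → ∏δ k (suc d) f ≗ δ (suc k) (∏δ (suc k) d f)
  ∏δ-bottom k zero    f n rewrite +-identityʳ k = refl
  ∏δ-bottom k (suc d) f n = begin
    δ (suc k + suc d) (∏δ k (suc d) f) n
      ≡⟨ δ-cong (suc k + suc d) (∏δ-bottom k d f) n ⟩
    δ (suc k + suc d) (δ (suc k) (∏δ (suc k) d f)) n
      ≡⟨ δ-comm (suc k + suc d) (suc k) (∏δ (suc k) d f) n ⟩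
    δ (suc k) (δ (suc k + suc d) (∏δ (suc k) d f)) n
      ≡⟨ cong (λ e → δ (suc k) (δ (suc e) (∏δ (suc k) d f)) n) (+-suc k d) ⟩
    δ (suc k) (∏δ (suc k) (suc d) f) n ∎
    where open ≡-Reasoning

  -- Shanks' finite form of the pentagonal number theorem.

  triangle : ℕ → ℕ
  triangle zero    = 0
  triangle (suc k) = suc k + triangle k

  -- With r = k + d, the summand q^(r k + k (k + 1) / 2) ∏ (1 - q^i), k < i ≤ r,
  -- of Shanks' finite form of the pentagonal number theorem.
  term : (k d : ℕ) → Series → Series
  term k d f = shift ((k + d) * k + triangle k) (∏δ k d f)

  -- The sum `r = k + d` is constant along the recursion, so these are the summands of index `0` to
  -- `k` for one fixed `r`; `d = 0` gives the full sum.
  partialSum : (k d : ℕ) → Series → Series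
  partialSum zero    d f = term 0 d f
  partialSum (suc k) d f = partialSum k (suc d) f ⊕ term (suc k) d f

  x+y+y≡x : ∀ x y → (x ℙ.+ y) ℙ.+ y ≡ x
  x+y+y≡x x y rewrite ℙ.+-assoc x y y | ℙ.p+p≡0ℙ y = ℙ.+-identityʳ x

  private
    rotate : ∀ x y z → (x ℙ.+ y) ℙ.+ z ≡ (z ℙ.+ x) ℙ.+ y
    rotate x y z = trans (ℙ.+-comm (x ℙ.+ y) z) (sym (ℙ.+-assoc z x y))

  -- The left side is the change in the summand of index `k + 1` when `r` grows by one. The right
  -- side adds the increments claimed in `partialSum-step` for `k` and for `k + 1`, so the changes
  -- telescope over the index.
  term-step : ∀ k d f →
    term (suc k) (suc d) f ⊕ term (suc k) d f ≗
    shift (k + suc (k + suc d)) (term k (suc d) f) ⊕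
      shift (suc k + suc (suc k + d)) (term (suc k) d f)
  term-step k d f n = begin
    shift c (δ (suc (suc k) + d) Y) n ℙ.+ shift e Y n
      ≡⟨ cong (ℙ._+ shift e Y n)
           (trans (shift-⊕ c Y (shift (suc (suc k) + d) Y) n) (cong₂ ℙ._+_
             (cong (λ i → shift i Y n) (eq₁ k d (triangle (suc k))))
             (trans (shift-shift c (suc (suc k) + d) Y n)
                    (cong (λ i → shift i Y n) (eq₂ k d (triangle (suc k))))))) ⟩
    (shift (e + suc k) Y n ℙ.+ shift (suc k + suc (suc k + d) + e) Y n) ℙ.+ shift e Y n
      -- The exponents `e` and `e + suc k` together give the factor `1 - q^(k + 1)`, which
      -- `∏δ-bottom` absorbs to form `∏δ k (suc d) f`.
      ≡⟨ rotate (shift (e + suc k) Y n) _ _ ⟩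
    (shift e Y n ℙ.+ shift (e + suc k) Y n) ℙ.+ shift (suc k + suc (suc k + d) + e) Y n
      ≡⟨ cong₂ ℙ._+_
           (trans (cong (shift e Y n ℙ.+_) (sym (shift-shift e (suc k) Y n)))
             (trans (sym (shift-⊕ e Y (shift (suc k) Y) n))
                    (cong (λ i → shift i (δ (suc k) Y) n) (eq₃ k d (triangle k)))))
           (sym (shift-shift (suc k + suc (suc k + d)) e Y n)) ⟩
    shift (g + ((k + suc d) * k + triangle k)) (δ (suc k) Y) n ℙ.+ shift h (shift e Y) n
      ≡⟨ cong (ℙ._+ shift h (shift e Y) n)
           (sym (trans (shift-shift g ((k + suc d) * k + triangle k) (∏δ k (suc d) f) n)
                       (shift-cong (g + ((k + suc d) * k + triangle k)) (∏δ-bottom k d f) n))) ⟩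
    shift g (term k (suc d) f) n ℙ.+ shift h (term (suc k) d f) n ∎
    where
    open ≡-Reasoning
    Y = ∏δ (suc k) d f
    c = (suc k + suc d) * suc k + triangle (suc k)
    e = (suc k + d) * suc k + triangle (suc k)
    g = k + suc (k + suc d)
    h = suc k + suc (suc k + d)
    eq₁ : ∀ k d t → (suc k + suc d) * suc k + t ≡ (suc k + d) * suc k + t + suc k
    eq₁ = solve-∀
    eq₂ : ∀ k d t → (suc k + suc d) * suc k + t + (suc (suc k) + d) ≡
                    suc k + suc (suc k + d) + ((suc k + d) * suc k + t)
    eq₂ = solve-∀
    eq₃ : ∀ k d t → (suc k + d) * suc k + (suc k + t) ≡
                    k + suc (k + suc d) + ((k + suc d) * k + t)
    eq₃ = solve-∀

  -- Induction on `k`: after `term-step` the increment for the smaller index occurs twice and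
  -- cancels modulo 2. At index `0` the change comes from the one new factor `1 - q^(d + 1)`.
  partialSum-step : ∀ k d f →
    partialSum k (suc d) f ⊕ partialSum k d f ≗ shift (k + suc (k + d)) (term k d f)
  partialSum-step zero d f n rewrite *-zeroʳ d = begin
    (∏δ 0 d f n ℙ.+ x) ℙ.+ ∏δ 0 d f n ≡⟨ rotate (∏δ 0 d f n) _ _ ⟩
    (∏δ 0 d f n ℙ.+ ∏δ 0 d f n) ℙ.+ x ≡⟨ cong (ℙ._+ x) (ℙ.p+p≡0ℙ (∏δ 0 d f n)) ⟩
    x ∎
    where
    open ≡-Reasoning
    x = shift (suc d) (∏δ 0 d f) n
  partialSum-step (suc k) d f n = begin
    (partialSum k (suc (suc d)) f n ℙ.+ term (suc k) (suc d) f n) ℙ.+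
      (partialSum k (suc d) f n ℙ.+ term (suc k) d f n)
      ≡⟨ interchange (partialSum k (suc (suc d)) f n) _ _ _ ⟩
    (partialSum k (suc (suc d)) f n ℙ.+ partialSum k (suc d) f n) ℙ.+
      (term (suc k) (suc d) f n ℙ.+ term (suc k) d f n)
      ≡⟨ cong₂ ℙ._+_ (partialSum-step k (suc d) f n) (term-step k d f n) ⟩
    x ℙ.+ (x ℙ.+ y) ≡⟨ trans (ℙ.+-comm x (x ℙ.+ y)) (trans (cong (ℙ._+ x) (ℙ.+-comm x y)) (x+y+y≡x y x)) ⟩
    y ∎
    where
    open ≡-Reasoning
    x = shift (k + suc (k + suc d)) (term k (suc d) f) n
    y = shift (suc k + suc (suc k + d)) (term (suc k) d f) n

  -- Every summand of index at least `1` starts in a degree above `k + d`, so up to that degree only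
  -- the product of index `0` is visible.
  partialSum-low : ∀ k d f n → n ≤ k + d → partialSum k d f n ≡ ∏δ 0 (k + d) f n
  partialSum-low zero    d f n n≤ rewrite *-zeroʳ d = refl
  partialSum-low (suc k) d f n n≤ = begin
    partialSum k (suc d) f n ℙ.+ term (suc k) d f n
      ≡⟨ cong₂ ℙ._+_
           (partialSum-low k (suc d) f n (subst (n ≤_) (sym (+-suc k d)) n≤))
           (shift-< (∏δ (suc k) d f) (<-≤-trans (s≤s n≤) big)) ⟩
    ∏δ 0 (k + suc d) f n ℙ.+ 0ℙ
      ≡⟨ ℙ.+-identityʳ _ ⟩
    ∏δ 0 (k + suc d) f n
      ≡⟨ cong (λ e → ∏δ 0 e f n) (+-suc k d) ⟩
    ∏δ 0 (suc k + d) f n ∎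
    where
    open ≡-Reasoning
    big : suc (suc k + d) ≤ (suc k + d) * suc k + triangle (suc k)
    big = subst (_≤ (suc k + d) * suc k + triangle (suc k)) (+-comm (suc k + d) 1)
            (+-mono-≤ (m≤m*n (suc k + d) (suc k)) (s≤s z≤n))

  -- Multiplication by ∑ q^d over d in ds.
  applyExponents : List ℕ → Series → Series
  applyExponents []       f n = 0ℙ
  applyExponents (d ∷ ds) f n = shift d f n ℙ.+ applyExponents ds f n

  -- r (3 r + 1) / 2 and r (3 r - 1) / 2, written without division.
  pentagonal pentagonal⁻ : ℕ → ℕ
  pentagonal r = r * r + triangle r
  pentagonal⁻ zero    = 0
  pentagonal⁻ (suc r) = suc (r + r) + pentagonal r

  pentagonals : ℕ → List ℕ
  pentagonals zero    = 0 ∷ []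
  pentagonals (suc r) = pentagonal (suc r) ∷ pentagonal⁻ (suc r) ∷ pentagonals r

  -- Passing from `r` to `r + 1` adds two exponents: `partialSum-step` with `d = 0` contributes
  -- `pentagonal⁻ (suc r)`, and the new last summand, whose product is empty, contributes
  -- `pentagonal (suc r)`.
  partialSum-diagonal : ∀ r f → partialSum r 0 f ≗ applyExponents (pentagonals r) f
  partialSum-diagonal zero    f n = sym (ℙ.+-identityʳ (f n))
  partialSum-diagonal (suc r) f n = begin
    partialSum r 1 f n ℙ.+ term (suc r) 0 f n
      ≡⟨ cong (ℙ._+ term (suc r) 0 f n) (sym (x+y+y≡x (partialSum r 1 f n) (partialSum r 0 f n))) ⟩
    ((partialSum r 1 f n ℙ.+ partialSum r 0 f n) ℙ.+ partialSum r 0 f n) ℙ.+ term (suc r) 0 f n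
      ≡⟨ cong (λ x → (x ℙ.+ partialSum r 0 f n) ℙ.+ term (suc r) 0 f n)
           (trans (partialSum-step r 0 f n) (shift-shift (r + suc (r + 0)) _ f n)) ⟩
    (shift (r + suc (r + 0) + ((r + 0) * r + triangle r)) f n ℙ.+ partialSum r 0 f n) ℙ.+
      shift ((suc r + 0) * suc r + triangle (suc r)) f n
      ≡⟨ cong₂ (λ x y → (shift x f n ℙ.+ partialSum r 0 f n) ℙ.+ shift y f n)
           (eq₁ r (triangle r)) (eq₂ r (triangle (suc r))) ⟩
    (shift (pentagonal⁻ (suc r)) f n ℙ.+ partialSum r 0 f n) ℙ.+ shift (pentagonal (suc r)) f n
      ≡⟨ ℙ.+-comm (shift (pentagonal⁻ (suc r)) f n ℙ.+ partialSum r 0 f n) _ ⟩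
    shift (pentagonal (suc r)) f n ℙ.+ (shift (pentagonal⁻ (suc r)) f n ℙ.+ partialSum r 0 f n)
      ≡⟨ cong (λ x → shift (pentagonal (suc r)) f n ℙ.+ (shift (pentagonal⁻ (suc r)) f n ℙ.+ x))
           (partialSum-diagonal r f n) ⟩
    applyExponents (pentagonals (suc r)) f n ∎
    where
    open ≡-Reasoning
    eq₁ : ∀ r t → r + suc (r + 0) + ((r + 0) * r + t) ≡ suc (r + r) + (r * r + t)
    eq₁ = solve-∀
    eq₂ : ∀ r t → (suc r + 0) * suc r + t ≡ suc r * suc r + t
    eq₂ = solve-∀

  -- Two evaluations of Shanks' sum are compared: the exact one by pentagonal exponents and the
  -- product that it equals in low degrees.
  pentagonals-low : ∀ {r n} f → n ≤ r → applyExponents (pentagonals r) f n ≡ ∏δ 0 r f n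
  pentagonals-low {r} {n} f n≤r = begin
    applyExponents (pentagonals r) f n ≡⟨ sym (partialSum-diagonal r f n) ⟩
    partialSum r 0 f n ≡⟨ partialSum-low r 0 f n (subst (n ≤_) (sym (+-identityʳ r)) n≤r) ⟩
    ∏δ 0 (r + 0) f n ≡⟨ cong (λ e → ∏δ 0 e f n) (+-identityʳ r) ⟩
    ∏δ 0 r f n ∎
    where open ≡-Reasoning

  applyExponents-local : ∀ ds {f g} n → (∀ i → i ≤ n → f i ≡ g i) →
                         applyExponents ds f n ≡ applyExponents ds g n
  applyExponents-local []       n f≡g = refl
  applyExponents-local (d ∷ ds) n f≡g =
    cong₂ ℙ._+_ (shift-local d n f≡g) (applyExponents-local ds n f≡g)

  shift-applyExponents : ∀ d ds f →
    shift d (applyExponents ds f) ≗ applyExponents ds (shift d f)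
  shift-applyExponents d []       f n = shift-0 d n
    where
    shift-0 : ∀ d n → shift d (λ _ → 0ℙ) n ≡ 0ℙ
    shift-0 zero    n       = refl
    shift-0 (suc d) zero    = refl
    shift-0 (suc d) (suc n) = shift-0 d n
  shift-applyExponents d (e ∷ ds) f n
    rewrite shift-⊕ d (shift e f) (applyExponents ds f) n | shift-comm d e f n =
    cong (shift e (shift d f) n ℙ.+_) (shift-applyExponents d ds f n)

  applyExponents-⊕ : ∀ ds f g → applyExponents ds (f ⊕ g) ≗ applyExponents ds f ⊕ applyExponents ds g
  applyExponents-⊕ []       f g n = refl
  applyExponents-⊕ (d ∷ ds) f g n rewrite shift-⊕ d f g n | applyExponents-⊕ ds f g n =
    interchange (shift d f n) (shift d g n) (applyExponents ds f n) (applyExponents ds g n)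

  applyExponents-comm : ∀ ds es f →
    applyExponents ds (applyExponents es f) ≗ applyExponents es (applyExponents ds f)
  applyExponents-comm ds []       f n = applyExponents-0 ds n
    where
    applyExponents-0 : ∀ ds n → applyExponents ds (λ _ → 0ℙ) n ≡ 0ℙ
    applyExponents-0 []       n = refl
    applyExponents-0 (d ∷ ds) n =
      cong₂ ℙ._+_ (shift-applyExponents d [] (λ _ → 0ℙ) n) (applyExponents-0 ds n)
  applyExponents-comm ds (e ∷ es) f n = begin
    applyExponents ds (shift e f ⊕ applyExponents es f) n
      ≡⟨ applyExponents-⊕ ds (shift e f) (applyExponents es f) n ⟩
    applyExponents ds (shift e f) n ℙ.+ applyExponents ds (applyExponents es f) n
      ≡⟨ cong₂ ℙ._+_ (sym (shift-applyExponents e ds f n)) (applyExponents-comm ds es f n) ⟩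
    applyExponents (e ∷ es) (applyExponents ds f) n ∎
    where open ≡-Reasoning

-- Cardinalities by injection, and counting modulo 2.

module Counting where
  open import Data.List.Base using (List; []; _∷_; length; filter)
  open import Data.List.Membership.Propositional using (_∈_)
  open import Data.List.Membership.Propositional.Properties using (∈-∃++)
  open import Data.List.Relation.Binary.Permutation.Propositional using (_↭_)
  open import Data.List.Relation.Binary.Permutation.Propositional.Properties using (∈-resp-↭; shift; ↭-length)
  open import Data.List.Relation.Unary.All as All using (All; []; _∷_)
  open import Data.List.Relation.Unary.Any using (here; there)
  open import Data.List.Relation.Unary.Unique.Propositional using (Unique; []; _∷_)
  open import Data.Nat.Base using (_≤_; z≤n; s≤s; parity; suc)
  open import Data.Nat.Properties using (≤-trans; ≤-reflexive)
  open import Data.Bool.Base using (true; false; if_then_else_)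
  open import Data.Parity.Base as ℙ using (Parity; 0ℙ; 1ℙ)
  import Data.Parity.Properties as ℙ
  open import Algebra.Properties.CommutativeSemigroup ℙ.+-commutativeSemigroup using (interchange)
  open import Data.Product.Base using (∃-syntax; _×_; _,_)
  open import Relation.Nullary using (Dec; does; contradiction)
  open import Relation.Unary using (Pred; Decidable)
  open import Relation.Binary.PropositionalEquality
  open import Level using (Level)

  private variable
    a b r : Level
    A B : Set a

  ∈⇒↭∷ : {x : A} {xs : List A} → x ∈ xs → ∃[ zs ] xs ↭ x ∷ zs
  ∈⇒↭∷ {x = x} x∈ with ys , zs , refl ← ∈-∃++ x∈ = _ , shift x ys zs

  -- Induction on `xs`: the partner `y` of the head is discarded from `ys`; by injectivity no later
  -- entry is related to `y`, so the rest keeps its partners in `zs`. A relation can be read in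
  -- either direction, which serves for bijections.
  length-≤-relation : {R : A → B → Set r} {xs : List A} {ys : List B} → Unique xs →
    (∀ {x} → x ∈ xs → ∃[ y ] y ∈ ys × R x y) →
    (∀ {x x′ y} → x ∈ xs → x′ ∈ xs → R x y → R x′ y → x ≡ x′) →
    length xs ≤ length ys
  length-≤-relation []         image inj = z≤n
  length-≤-relation {R = R} {xs = x ∷ xs} (x∉ ∷ u) image inj
    with y , y∈ , Rxy ← image (here refl)
    with zs , p ← ∈⇒↭∷ y∈ =
    ≤-trans (s≤s (length-≤-relation {R = R} u image′ (λ i j → inj (there i) (there j))))
            (≤-reflexive (sym (↭-length p)))
    where
    image′ : ∀ {x′} → x′ ∈ xs → ∃[ y′ ] y′ ∈ zs × R x′ y′
    image′ x′∈ with image (there x′∈)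
    ... | y′ , y′∈ , Rx′y′ with ∈-resp-↭ p y′∈
    ...   | there y′∈zs = y′ , y′∈zs , Rx′y′
    ...   | here refl   =
      contradiction (inj (here refl) (there x′∈) Rxy Rx′y′) (All.lookup x∉ x′∈)

  Σℙ : (A → Parity) → List A → Parity
  Σℙ f []       = 0ℙ
  Σℙ f (x ∷ xs) = f x ℙ.+ Σℙ f xs

  Σℙ-cong : {f g : A → Parity} (xs : List A) → (∀ {x} → x ∈ xs → f x ≡ g x) → Σℙ f xs ≡ Σℙ g xs
  Σℙ-cong []       f≡g = refl
  Σℙ-cong (x ∷ xs) f≡g = cong₂ ℙ._+_ (f≡g (here refl)) (Σℙ-cong xs (λ x∈ → f≡g (there x∈)))

  Σℙ-+ : (f g : A → Parity) (xs : List A) → Σℙ (λ x → f x ℙ.+ g x) xs ≡ Σℙ f xs ℙ.+ Σℙ g xs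
  Σℙ-+ f g []       = refl
  Σℙ-+ f g (x ∷ xs) rewrite Σℙ-+ f g xs = interchange (f x) (g x) (Σℙ f xs) (Σℙ g xs)

  Σℙ-0 : (xs : List A) → Σℙ (λ _ → 0ℙ) xs ≡ 0ℙ
  Σℙ-0 []       = refl
  Σℙ-0 (_ ∷ xs) = Σℙ-0 xs

  Σℙ-swap : (f : A → B → Parity) (xs : List A) (ys : List B) →
    Σℙ (λ x → Σℙ (f x) ys) xs ≡ Σℙ (λ y → Σℙ (λ x → f x y) xs) ys
  Σℙ-swap f []       ys = sym (Σℙ-0 ys)
  Σℙ-swap f (x ∷ xs) ys =
    trans (cong (Σℙ (f x) ys ℙ.+_) (Σℙ-swap f xs ys))
          (sym (Σℙ-+ (f x) (λ y → Σℙ (λ x′ → f x′ y) xs) ys))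

  -- The Iverson bracket with values modulo 2.
  ⟦_⟧ : {P : Set r} → Dec P → Parity
  ⟦ P? ⟧ = if does P? then 1ℙ else 0ℙ

  parity-suc : ∀ n → parity (suc n) ≡ 1ℙ ℙ.+ parity n
  parity-suc n = ℙ.+-homo-+ 1 n

  parity-filter : {P : Pred A r} (P? : Decidable P) (xs : List A) →
    parity (length (filter P? xs)) ≡ Σℙ (λ x → ⟦ P? x ⟧) xs
  parity-filter P? []       = refl
  parity-filter P? (x ∷ xs) with does (P? x)
  ... | true  = trans (parity-suc (length (filter P? xs))) (cong (1ℙ ℙ.+_) (parity-filter P? xs))
  ... | false = parity-filter P? xs

-- Partitions that contain given parts.

module Partitions where
  open Series
  open Counting
  open import Data.Nat.Base using (ℕ; zero; suc; _+_; _≤_; _<_; z≤n; s≤s; parity)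
  open import Data.Nat.Properties
  open import Data.Nat.ListAction using (sum)
  open import Data.Nat.ListAction.Properties using (sum-↭)
  open import Data.Parity.Base as ℙ using (Parity; 0ℙ; 1ℙ)
  import Data.Parity.Properties as ℙ
  open import Data.List.Base using (List; []; _∷_; length; filter)
  open import Data.List.Properties using (filter-all; filter-none)
  open import Data.List.Membership.Propositional using (_∈_; _∉_)
  open import Data.List.Membership.Propositional.Properties using (∈-filter⁺; ∈-filter⁻)
  open import Data.List.Membership.DecPropositional _≟_ using (_∈?_)
  open import Data.List.Relation.Binary.Permutation.Propositional using (_↭_; prep; ↭-sym; ↭-trans; ↭⇒↭ₛ)
  open import Data.List.Relation.Binary.Permutation.Propositional.Properties
    using (∈-resp-↭; All-resp-↭; drop-∷)
  open import Data.List.Relation.Binary.Pointwise using (Pointwise-≡⇒≡)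
  open import Data.List.Relation.Unary.All as All using (All; []; _∷_)
  open import Data.List.Relation.Unary.Any using (here; there)
  open import Data.List.Relation.Unary.Unique.Propositional using (Unique; []; _∷_)
  open import Data.List.Relation.Unary.Unique.Propositional.Properties using (filter⁺; Unique[x∷xs]⇒x∉xs)
  open import Data.List.Relation.Unary.Sorted.TotalOrder.Properties using (↗↭↗⇒≋)
  open import Data.Product.Base using (∃-syntax; _×_; _,_; proj₁; proj₂)
  open import Relation.Nullary using (yes; no; ¬_; contradiction; _×-dec_)
  open import Relation.Unary using (Pred; Decidable)
  open import Relation.Binary.PropositionalEquality
  open import Level using (0ℓ)
  import Relation.Binary.Construct.Flip.EqAndOrd as Flip
  open import Relation.Binary.Bundles using (DecTotalOrder)
  open import Data.List.Sort (Flip.decTotalOrder ≤-decTotalOrder) using (sort; sort-↭; sort-↗)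

  part≤sum : ∀ {x} {xs : List ℕ} → x ∈ xs → x ≤ sum xs
  part≤sum {xs = x ∷ xs} (here refl) = m≤m+n x (sum xs)
  part≤sum {xs = x ∷ xs} (there x∈)  = ≤-trans (part≤sum x∈) (m≤n+m (sum xs) x)

  -- A non-increasing list is determined by its multiset of entries, so correspondences between
  -- partitions need only be given up to permutation.
  partition-≡ : ∀ {n n′ xs ys} → IsPartition n xs → IsPartition n′ ys → xs ↭ ys → xs ≡ ys
  partition-≡ (_ , xs↘ , _) (_ , ys↘ , _) p =
    Pointwise-≡⇒≡ (↗↭↗⇒≋ (DecTotalOrder.totalOrder (Flip.decTotalOrder ≤-decTotalOrder)) xs↘ ys↘ (↭⇒↭ₛ p))

  sort-partition : ∀ xs → All (0 <_) xs → IsPartition (sum xs) (sort xs)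
  sort-partition xs pos = All-resp-↭ (↭-sym (sort-↭ xs)) pos , sort-↗ xs , sum-↭ (sort-↭ xs)

  count : {P : Pred (List ℕ) 0ℓ} → Decidable P → Series
  count P? n = parity (length (filter P? (partitions n)))

  numPartitions : Series
  numPartitions n = parity (length (partitions n))

  count-all : {P : Pred (List ℕ) 0ℓ} (P? : Decidable P) →
    (∀ {n xs} → IsPartition n xs → P xs) → count P? ≗ numPartitions
  count-all P? all n =
    cong (λ xs → parity (length xs)) (filter-all P? (All.tabulate (λ x∈ → all (∈-partitions⁻ {n} x∈))))

  count-none : {P : Pred (List ℕ) 0ℓ} (P? : Decidable P) (n : ℕ) →
    (∀ {xs} → IsPartition n xs → ¬ P xs) → count P? n ≡ 0ℙ
  count-none P? n none =
    cong (λ xs → parity (length xs)) (filter-none P? (All.tabulate (λ x∈ → none (∈-partitions⁻ {n} x∈))))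

  -- Deleting one copy of the part x is a bijection onto the partitions of n - x.
  count-remove : {P Q : Pred (List ℕ) 0ℓ} (P? : Decidable P) (Q? : Decidable Q) (x : ℕ) → 0 < x →
    (∀ {xs} → P xs → x ∈ xs) →
    (∀ {xs ys} → xs ↭ x ∷ ys → P xs → Q ys) →
    (∀ {xs ys} → xs ↭ x ∷ ys → Q ys → P xs) →
    count P? ≗ shift x (count Q?)
  count-remove {P} {Q} P? Q? x 0<x P⇒∈ P⇒Q Q⇒P n with x ≤? n
  ... | no x≰n = trans
    (count-none P? n (λ { (_ , _ , refl) Pxs → x≰n (part≤sum (P⇒∈ Pxs)) }))
    (sym (shift-< (count Q?) (≰⇒> x≰n)))
  ... | yes x≤n with k , refl ← m≤n⇒∃[o]m+o≡n x≤n =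
    -- One relation, read in both directions, injects each set into the other: `remove` and `insert`
    -- supply the partners, and `partition-≡` gives injectivity.
    trans (cong parity (≤-antisym
      (length-≤-relation {R = λ xs ys → xs ↭ x ∷ ys} (filter⁺ P? (partitions-unique (x + k))) remove
        (λ i j p q → partition-≡ (isP i) (isP j) (↭-trans p (↭-sym q))))
      (length-≤-relation {R = λ ys xs → xs ↭ x ∷ ys} (filter⁺ Q? (partitions-unique k)) insert
        (λ i j p q → partition-≡ (isQ i) (isQ j) (drop-∷ (↭-trans (↭-sym p) q))))))
    (sym (shift-+ x (count Q?) k))
    where
    isP : ∀ {xs} → xs ∈ filter P? (partitions (x + k)) → IsPartition (x + k) xs
    isP i = ∈-partitions⁻ {x + k} (proj₁ (∈-filter⁻ P? {xs = partitions (x + k)} i))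
    isQ : ∀ {xs} → xs ∈ filter Q? (partitions k) → IsPartition k xs
    isQ i = ∈-partitions⁻ {k} (proj₁ (∈-filter⁻ Q? {xs = partitions k} i))
    remove : ∀ {xs} → xs ∈ filter P? (partitions (x + k)) →
             ∃[ ys ] ys ∈ filter Q? (partitions k) × xs ↭ x ∷ ys
    remove {xs} i with isP i | proj₂ (∈-filter⁻ P? {xs = partitions (x + k)} i)
    ... | pos , _ , sum≡ | Pxs with zs , p ← ∈⇒↭∷ (P⇒∈ Pxs) =
      sort zs , ∈-filter⁺ Q? (∈-partitions is) (P⇒Q q Pxs) , q
      where
      q : xs ↭ x ∷ sort zs
      q = ↭-trans p (prep x (↭-sym (sort-↭ zs)))
      is : IsPartition k (sort zs)
      is = subst (λ s → IsPartition s (sort zs))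
             (+-cancelˡ-≡ x (sum zs) k (trans (sym (sum-↭ p)) sum≡))
             (sort-partition zs (All.tail (All-resp-↭ p pos)))
    insert : ∀ {ys} → ys ∈ filter Q? (partitions k) →
             ∃[ xs ] xs ∈ filter P? (partitions (x + k)) × xs ↭ x ∷ ys
    insert {ys} i with isQ i | proj₂ (∈-filter⁻ Q? {xs = partitions k} i)
    ... | pos , _ , sum≡ | Qys =
      sort (x ∷ ys) ,
      ∈-filter⁺ P? (∈-partitions (subst (λ s → IsPartition s (sort (x ∷ ys))) (cong (x +_) sum≡)
        (sort-partition (x ∷ ys) (0<x ∷ pos)))) (Q⇒P (sort-↭ (x ∷ ys)) Qys) ,
      sort-↭ (x ∷ ys)

  contains? : ∀ xs → Decidable (λ (ys : List ℕ) → All (_∈ ys) xs)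
  contains? xs ys = All.all? (_∈? ys) xs

  -- The required parts are deleted one after another by `count-remove`. Distinctness ensures that
  -- deleting a copy of `x` leaves the other required parts in place.
  count-contains : ∀ {xs} → Unique xs → All (0 <_) xs →
    count (contains? xs) ≗ shift (sum xs) numPartitions
  count-contains {[]}     _        _            n = count-all (contains? []) (λ _ → []) n
  count-contains {x ∷ xs} u@(_ ∷ v) (0<x ∷ pos) n = begin
    count (contains? (x ∷ xs)) n
      ≡⟨ count-remove (contains? (x ∷ xs)) (contains? xs) x 0<x All.head
           (λ p c → All.tabulate (λ y∈ → drop (All.lookup (All.tail c) y∈) y∈ p))
           (λ p c → ∈-resp-↭ (↭-sym p) (here refl) ∷ All.map (λ y∈ → ∈-resp-↭ (↭-sym p) (there y∈)) c) n ⟩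
    shift x (count (contains? xs)) n
      ≡⟨ shift-cong x (count-contains v pos) n ⟩
    shift x (shift (sum xs) numPartitions) n
      ≡⟨ shift-shift x (sum xs) numPartitions n ⟩
    shift (x + sum xs) numPartitions n ∎
    where
    open ≡-Reasoning
    drop : ∀ {y ys zs} → y ∈ ys → y ∈ xs → ys ↭ x ∷ zs → y ∈ zs
    drop y∈ys y∈xs p with ∈-resp-↭ p y∈ys
    ... | there y∈zs = y∈zs
    ... | here refl  = contradiction y∈xs (Unique[x∷xs]⇒x∉xs u)

  -- Partitions into large parts, and Euler's recurrence.

  above? : ∀ r → Decidable (All (r <_))
  above? r = All.all? (r <?_)

  -- Among the partitions with all parts above `r`, those with a part `r + 1` correspond, by
  -- deleting one copy of it, to all partitions with parts above `r`. So the factor `1 - q^(r + 1)`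
  -- sieves out the part `r + 1`.
  count-above-suc : ∀ r → count (above? (suc r)) ≗ δ (suc r) (count (above? r))
  count-above-suc r n = begin
    count (above? (suc r)) n
      ≡⟨ sym (x+y+y≡x (count (above? (suc r)) n) (shift (suc r) (count (above? r)) n)) ⟩
    (count (above? (suc r)) n ℙ.+ shift (suc r) (count (above? r)) n) ℙ.+
      shift (suc r) (count (above? r)) n
      ≡⟨ cong (ℙ._+ shift (suc r) (count (above? r)) n) (sym split) ⟩
    δ (suc r) (count (above? r)) n ∎
    where
    open ≡-Reasoning
    min? : Decidable (λ xs → suc r ∈ xs × All (r <_) xs)
    min? xs = (suc r ∈? xs) ×-dec above? r xs

    cases : ∀ xs → ⟦ above? r xs ⟧ ≡ ⟦ above? (suc r) xs ⟧ ℙ.+ ⟦ min? xs ⟧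
    cases xs with above? r xs | above? (suc r) xs | suc r ∈? xs
    ... | yes _ | yes q | yes i = contradiction (All.lookup q i) (<-irrefl refl)
    ... | yes _ | yes _ | no _  = refl
    ... | yes _ | no _  | yes _ = refl
    ... | yes p | no ¬q | no ∉  =
      contradiction (All.tabulate (λ x∈ → ≤∧≢⇒< (All.lookup p x∈) (λ { refl → ∉ x∈ }))) ¬q
    ... | no ¬p | yes q | _     = contradiction (All.map <⇒≤ q) ¬p
    ... | no _  | no _  | yes _ = refl
    ... | no _  | no _  | no _  = refl

    split : count (above? r) n ≡ count (above? (suc r)) n ℙ.+ shift (suc r) (count (above? r)) n
    split = begin
      count (above? r) n
        ≡⟨ parity-filter (above? r) (partitions n) ⟩
      Σℙ (λ xs → ⟦ above? r xs ⟧) (partitions n)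
        ≡⟨ Σℙ-cong (partitions n) (λ {xs} _ → cases xs) ⟩
      Σℙ (λ xs → ⟦ above? (suc r) xs ⟧ ℙ.+ ⟦ min? xs ⟧) (partitions n)
        ≡⟨ Σℙ-+ (λ xs → ⟦ above? (suc r) xs ⟧) (λ xs → ⟦ min? xs ⟧) (partitions n) ⟩
      Σℙ (λ xs → ⟦ above? (suc r) xs ⟧) (partitions n) ℙ.+ Σℙ (λ xs → ⟦ min? xs ⟧) (partitions n)
        ≡⟨ sym (cong₂ ℙ._+_ (parity-filter (above? (suc r)) (partitions n))
                            (parity-filter min? (partitions n))) ⟩
      count (above? (suc r)) n ℙ.+ count min? n
        ≡⟨ cong (count (above? (suc r)) n ℙ.+_)
             (count-remove min? (above? r) (suc r) (s≤s z≤n) proj₁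
               (λ p (_ , c) → All.tail (All-resp-↭ p c))
               (λ p c → ∈-resp-↭ (↭-sym p) (here refl) , All-resp-↭ (↭-sym p) (≤-refl ∷ c)) n) ⟩
      count (above? (suc r)) n ℙ.+ shift (suc r) (count (above? r)) n ∎

  ∏δ-numPartitions : ∀ r → ∏δ 0 r numPartitions ≗ count (above? r)
  ∏δ-numPartitions zero    n = sym (count-all (above? 0) proj₁ n)
  ∏δ-numPartitions (suc r) n =
    trans (δ-cong (suc r) (∏δ-numPartitions r) n) (sym (count-above-suc r n))

  one : Series
  one zero    = 1ℙ
  one (suc n) = 0ℙ

  shift-one : ∀ {d n} → d ≢ n → shift d one n ≡ 0ℙ
  shift-one {zero}  {zero}  d≢n = contradiction refl d≢n
  shift-one {zero}  {suc n} d≢n = refl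
  shift-one {suc d} {zero}  d≢n = refl
  shift-one {suc d} {suc n} d≢n = shift-one (λ e → d≢n (cong suc e))

  applyExponents-one : ∀ {ds n} → n ∉ ds → applyExponents ds one n ≡ 0ℙ
  applyExponents-one {[]}     n∉ = refl
  applyExponents-one {d ∷ ds} {n} n∉ =
    cong₂ ℙ._+_ (shift-one {d} {n} (λ { refl → n∉ (here refl) })) (applyExponents-one (λ n∈ → n∉ (there n∈)))

  -- A part above `r` would exceed `n`, which leaves only the empty partition of `0`.
  count-above-low : ∀ {r n} → n ≤ r → count (above? r) n ≡ one n
  count-above-low {r} {zero}  _   = refl
  count-above-low {r} {suc n} n<r = count-none (above? r) (suc n) none
    where
    none : ∀ {xs} → IsPartition (suc n) xs → ¬ All (r <_) xs
    none {x ∷ xs} (_ , _ , sum≡) (r<x ∷ _) =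
      <⇒≱ (≤-<-trans n<r r<x) (subst (x ≤_) sum≡ (m≤m+n x (sum xs)))

  -- Up to degree `r` the pentagonal sum acts as the product `∏δ 0 r`, which sieves all parts up to
  -- `r` out of the partition series.
  euler-recurrence : ∀ {r n} → n ≤ r → applyExponents (pentagonals r) numPartitions n ≡ one n
  euler-recurrence {r} {n} n≤r =
    trans (pentagonals-low numPartitions n≤r) (trans (∏δ-numPartitions r n) (count-above-low n≤r))

-- The series of `p A a` modulo 2.

module MexSeries where
  open Series
  open Counting
  open Partitions
  open import Data.Nat.Base as ℕ
    using (ℕ; zero; suc; _+_; _*_; _≤_; _<_; z≤n; s≤s; ∣_-_∣; NonZero; parity; >-nonZero⁻¹)
  open import Data.Nat.Properties
  open import Data.Nat.Divisibility using (_∣_; divides; ∣⇒≤; *-monoˡ-∣; *-cancelʳ-∣)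
  open import Data.Nat.ListAction using (sum)
  open import Data.Parity.Base as ℙ using (Parity; 0ℙ; 1ℙ)
  import Data.Parity.Properties as ℙ
  open import Data.List.Base using (List; []; _∷_; map; downFrom)
  open import Data.List.Membership.Propositional using (_∈_; _∉_)
  open import Data.List.Membership.DecPropositional _≟_ using (_∈?_)
  open import Data.List.Relation.Unary.All using (All; []; _∷_)
  open import Data.List.Relation.Unary.Unique.Propositional using (Unique; []; _∷_)
  open import Data.Product.Base using (∃-syntax; _×_; _,_)
  open import Data.Sum.Base using (inj₁; inj₂)
  open import Relation.Nullary using (Dec; yes; no; contradiction)
  open import Relation.Binary.PropositionalEquality

  parity≡0⇒2∣ : ∀ k → parity k ≡ 0ℙ → 2 ∣ k
  parity≡0⇒2∣ zero          _ = divides 0 refl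
  parity≡0⇒2∣ (suc (suc k)) e with divides q refl ← parity≡0⇒2∣ k e = divides (suc q) refl

  2∣⇒parity≡0 : ∀ {k} → 2 ∣ k → parity k ≡ 0ℙ
  2∣⇒parity≡0 (divides q refl) = trans (ℙ.*-homo-* q 2) (ℙ.*-zeroʳ (parity q))

  -- `downFrom K` is scanned from `K - 1` down: the indices above `κ` contribute nothing, and then
  -- each of the `κ + 1` remaining ones contributes `1`.
  Σ-initial : ∀ {P : ℕ → Set} (P? : ∀ k → Dec (P k)) κ →
    (∀ {k} → k ≤ κ → P k) → (∀ {k} → P k → k ≤ κ) →
    ∀ K → κ < K → Σℙ (λ k → ⟦ P? k ⟧) (downFrom K) ≡ parity (suc κ)
  Σ-initial P? κ ≤⇒P P⇒≤ (suc K) (s≤s κ≤K) with m≤n⇒m<n∨m≡n κ≤K | P? K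
  ... | inj₁ κ<K  | yes p = contradiction (P⇒≤ p) (<⇒≱ κ<K)
  ... | inj₁ κ<K  | no _  = Σ-initial P? κ ≤⇒P P⇒≤ K κ<K
  ... | inj₂ refl | no ¬p = contradiction (≤⇒P ≤-refl) ¬p
  ... | inj₂ refl | yes _ = trans (cong (1ℙ ℙ.+_) (full K ≤-refl)) (sym (parity-suc K))
    where
    full : ∀ j → j ≤ K → Σℙ (λ k → ⟦ P? k ⟧) (downFrom j) ≡ parity j
    full zero    _   = refl
    full (suc j) j<K with P? j
    ... | yes _ = trans (cong (1ℙ ℙ.+_) (full j (<⇒≤ j<K))) (sym (parity-suc j))
    ... | no ¬p = contradiction (≤⇒P (<⇒≤ j<K)) ¬p

  module _ (A a : ℕ) .{{_ : NonZero A}} .{{_ : NonZero a}} (a≤A : a ≤ A) where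

    progression : ℕ → ℕ
    progression i = a + i * A

    -- The largest term comes first, so the list grows at its head; the sum of `initial k` is `T_k`.
    initial : ℕ → List ℕ
    initial k = map progression (downFrom k)

    progression-mono-< : ∀ {i j} → i < j → progression i < progression j
    progression-mono-< i<j = +-monoʳ-< a (*-monoˡ-< A i<j)

    progression-pos : ∀ i → 0 < progression i
    progression-pos i = ≤-trans (>-nonZero⁻¹ a) (m≤m+n a (i * A))

    ∣progression-a∣ : ∀ i → ∣ progression i - a ∣ ≡ i * A
    ∣progression-a∣ i = trans (∣-∣-comm (progression i) a) (∣m-m+n∣≡n a (i * A))

    initial-All : ∀ {P : ℕ → Set} k → (∀ {i} → i < k → P (progression i)) → All P (initial k)
    initial-All zero    p = []
    initial-All (suc k) p = p ≤-refl ∷ initial-All k (λ i<k → p (m≤n⇒m≤1+n i<k))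

    initial-All⁻ : ∀ {P : ℕ → Set} {k} → All P (initial k) → ∀ {i} → i < k → P (progression i)
    initial-All⁻ {k = suc k} (p ∷ ps) {i} (s≤s i≤k) with m≤n⇒m<n∨m≡n i≤k
    ... | inj₁ i<k  = initial-All⁻ ps i<k
    ... | inj₂ refl = p

    initial-unique : ∀ k → Unique (initial k)
    initial-unique zero    = []
    initial-unique (suc k) =
      initial-All k (λ i<k e → <⇒≢ (progression-mono-< i<k) (sym e)) ∷ initial-unique k

    -- For a congruent `x < a`, `A` would divide `a - x`, which is positive and less than `a`; this
    -- is where `a ≤ A` enters.
    ≡a⇒progression : ∀ {x} → 0 < x → x ≡ a [mod A ] → ∃[ k ] x ≡ progression k
    ≡a⇒progression {x} 0<x A∣ with a ≤? x
    ≡a⇒progression {x} 0<x (divides q e) | yes a≤x =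
      q , trans (sym (m+[n∸m]≡n a≤x)) (cong (a +_) (trans (sym (m≤n⇒∣n-m∣≡n∸m a≤x)) e))
    ≡a⇒progression {x} 0<x A∣ | no a≰x =
      contradiction a≤A (<⇒≱ (≤-<-trans (∣⇒≤ {{ℕ.>-nonZero (m<n⇒0<n∸m x<a)}} (subst (A ∣_) (m≤n⇒∣m-n∣≡n∸m (<⇒≤ x<a)) A∣))
        (∸-monoʳ-< 0<x (<⇒≤ x<a))))
      where
      x<a : x < a
      x<a = ≰⇒> a≰x

    mex-index : ∀ xs → ∃[ κ ] mex A a xs ≡ progression κ
                              × (∀ {i} → i < κ → progression i ∈ xs) × progression κ ∉ xs
    mex-index xs with mex-isLeast A a xs
    ... | (0<mex , mex≡a , mex∉) , least with ≡a⇒progression 0<mex mex≡a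
    ... | κ , mex≡ = κ , mex≡ , before , subst (_∉ xs) mex≡ mex∉
      where
      before : ∀ {i} → i < κ → progression i ∈ xs
      before {i} i<κ with progression i ∈? xs
      ... | yes i∈ = i∈
      ... | no i∉  = contradiction
        (least (progression i)
          (progression-pos i , subst (A ∣_) (sym (∣progression-a∣ i)) (divides i refl) , i∉))
        (<⇒≱ (subst (progression i <_) (sym mex≡) (progression-mono-< i<κ)))

    -- If mex = a + κ A then the k with the first k terms all present are 0, …, κ,
    -- so their number is odd exactly when κ is even.
    mex-parity : ∀ {n xs} → IsPartition n xs → ∀ K → n < K →
      ⟦ mex A a xs ≡? a [mod 2 * A ] ⟧ ≡ Σℙ (λ k → ⟦ contains? (initial k) xs ⟧) (downFrom K)
    mex-parity {n} {xs} (_ , _ , sum≡) K n<K with mex-index xs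
    ... | κ , mex≡ , before , κ∉ = trans lhs (sym
      (Σ-initial (λ k → contains? (initial k) xs) κ
        (λ {k} k≤κ → initial-All k (λ i<k → before (<-≤-trans i<k k≤κ)))
        (λ c → ≮⇒≥ (λ κ<k → κ∉ (initial-All⁻ c κ<k)))
        -- Cutting the sum off at `K` loses nothing, since `κ ≤ n < K`.
        K (≤-<-trans (κ≤n κ before) n<K)))
      where
      diff : ∣ mex A a xs - a ∣ ≡ κ * A
      diff = trans (cong (∣_- a ∣) mex≡) (∣progression-a∣ κ)

      lhs : ⟦ mex A a xs ≡? a [mod 2 * A ] ⟧ ≡ parity (suc κ)
      lhs with mex A a xs ≡? a [mod 2 * A ]
      ... | yes d = trans (cong (1ℙ ℙ.+_)
              (sym (2∣⇒parity≡0 (*-cancelʳ-∣ {2} {κ} A (subst (2 * A ∣_) diff d))))) (sym (parity-suc κ))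
      ... | no ¬d with parity κ in eq
      ...   | 0ℙ = contradiction (subst (2 * A ∣_) (sym diff) (*-monoˡ-∣ A (parity≡0⇒2∣ κ eq))) ¬d
      ...   | 1ℙ = sym (trans (parity-suc κ) (cong (1ℙ ℙ.+_) eq))

      κ≤n : ∀ κ → (∀ {i} → i < κ → progression i ∈ xs) → κ ≤ n
      κ≤n zero    _      = z≤n
      -- The last of the given parts is `a + i * A`, hence at least `i + 1`, and no part exceeds
      -- `n`.
      κ≤n (suc i) before = ≤-trans (+-mono-≤ (>-nonZero⁻¹ a) (m≤m*n i A))
        (subst (progression i ≤_) sum≡ (part≤sum (before ≤-refl)))

    pSeries : Series
    pSeries n = parity (p A a n)

    exponents : ℕ → List ℕ
    exponents K = map (λ k → sum (initial k)) (downFrom K)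

    -- Summing `mex-parity` over all partitions and exchanging the two sums counts, for each `k`,
    -- the partitions that contain `initial k`; they correspond to the partitions of `n - T_k`.
    pSeries-numPartitions : ∀ {n K} → n < K → pSeries n ≡ applyExponents (exponents K) numPartitions n
    pSeries-numPartitions {n} {K} n<K = begin
      pSeries n
        ≡⟨ parity-filter (λ xs → mex A a xs ≡? a [mod 2 * A ]) (partitions n) ⟩
      Σℙ (λ xs → ⟦ mex A a xs ≡? a [mod 2 * A ] ⟧) (partitions n)
        ≡⟨ Σℙ-cong (partitions n) (λ xs∈ → mex-parity (∈-partitions⁻ {n} xs∈) K n<K) ⟩
      Σℙ (λ xs → Σℙ (λ k → ⟦ contains? (initial k) xs ⟧) (downFrom K)) (partitions n)
        ≡⟨ Σℙ-swap (λ xs k → ⟦ contains? (initial k) xs ⟧) (partitions n) (downFrom K) ⟩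
      Σℙ (λ k → Σℙ (λ xs → ⟦ contains? (initial k) xs ⟧) (partitions n)) (downFrom K)
        ≡⟨ Σℙ-cong (downFrom K) (λ {k} _ →
             trans (sym (parity-filter (contains? (initial k)) (partitions n)))
                   (count-contains (initial-unique k) (initial-All k (λ {i} _ → progression-pos i)) n)) ⟩
      Σℙ (λ k → shift (sum (initial k)) numPartitions n) (downFrom K)
        ≡⟨ Σ-map (downFrom K) ⟩
      applyExponents (exponents K) numPartitions n ∎
      where
      open ≡-Reasoning
      Σ-map : ∀ ks → Σℙ (λ k → shift (sum (initial k)) numPartitions n) ks ≡
                     applyExponents (map (λ k → sum (initial k)) ks) numPartitions n
      Σ-map []       = refl
      Σ-map (k ∷ ks) = cong (shift (sum (initial k)) numPartitions n ℙ.+_) (Σ-map ks)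

    -- The pentagonal sum turns the partition series into `one`; commuted past `exponents K` it
    -- leaves the sum of the `q^(T_k)`, whose coefficient at `n` vanishes.
    pentagonals-pSeries : ∀ {r n K} → n ≤ r → n < K → n ∉ exponents K →
      applyExponents (pentagonals r) pSeries n ≡ 0ℙ
    pentagonals-pSeries {r} {n} {K} n≤r n<K n∉ = begin
      applyExponents (pentagonals r) pSeries n
        ≡⟨ applyExponents-local (pentagonals r) n
             (λ i i≤n → pSeries-numPartitions (≤-<-trans i≤n n<K)) ⟩
      applyExponents (pentagonals r) (applyExponents (exponents K) numPartitions) n
        ≡⟨ applyExponents-comm (pentagonals r) (exponents K) numPartitions n ⟩
      applyExponents (exponents K) (applyExponents (pentagonals r) numPartitions) n
        ≡⟨ applyExponents-local (exponents K) n (λ i i≤n → euler-recurrence (≤-trans i≤n n≤r)) ⟩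
      applyExponents (exponents K) one n
        ≡⟨ applyExponents-one n∉ ⟩
      0ℙ ∎
      where open ≡-Reasoning

-- Locating and counting the even values.

module EvenValues where
  open Series
  open Counting
  open Partitions
  open MexSeries
  open import Data.Nat.Base
    using (ℕ; zero; suc; _+_; _*_; _∸_; _≤_; _<_; z≤n; s≤s; NonZero; parity; >-nonZero⁻¹)
  open import Data.Nat.Properties
  open import Data.Nat.Divisibility using (_∣_)
  open import Data.Nat.ListAction using (sum)
  open import Data.Nat.Tactic.RingSolver using (solve-∀)
  open import Data.Parity.Base as ℙ using (Parity; 0ℙ; 1ℙ)
  import Data.Parity.Properties as ℙ
  open import Data.List.Base
    using (List; []; _∷_; _++_; map; filter; length; upTo; downFrom; applyUpTo; cartesianProductWith)
  open import Data.List.Properties using (length-++; length-map; length-upTo; length-downFrom)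
  open import Data.List.Membership.Propositional using (_∈_; find)
  open import Data.List.Membership.Propositional.Properties
    using (∈-map⁺; ∈-map⁻; ∈-++⁺ˡ; ∈-++⁺ʳ; ∈-++⁻; ∈-upTo⁻; ∈-downFrom⁺; ∈-filter⁺; ∈-applyUpTo⁺; ∈-cartesianProductWith⁺)
  open import Data.List.Membership.DecPropositional _≟_ using (_∈?_)
  open import Data.List.Relation.Unary.All as All using (All; []; _∷_)
  open import Data.List.Relation.Unary.Any as Any using (here; there; any?)
  open import Data.List.Relation.Unary.Unique.Propositional using (Unique; []; _∷_)
  open import Data.List.Relation.Unary.Unique.Propositional.Properties using (upTo⁺; map⁺; ++⁺)
  open import Data.Product.Base using (∃-syntax; _×_; _,_)
  open import Data.Sum.Base using (inj₁; inj₂)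
  open import Relation.Nullary using (yes; no; ¬_; contradiction)
  open import Relation.Binary.PropositionalEquality

  pentagonal⁻-≤ : ∀ r → pentagonal⁻ r ≤ pentagonal r
  pentagonal⁻-≤ zero    = z≤n
  pentagonal⁻-≤ (suc r) = subst (pentagonal⁻ (suc r) ≤_) (sym (eq r (triangle r))) (m≤n+m _ (suc r))
    where
    eq : ∀ r t → suc r * suc r + (suc r + t) ≡ suc r + (suc (r + r) + (r * r + t))
    eq = solve-∀

  pentagonal-mono : ∀ {r s} → r ≤ s → pentagonal r ≤ pentagonal s
  pentagonal-mono z≤n = z≤n
  pentagonal-mono {suc r} {suc s} (s≤s r≤s) =
    +-mono-≤ (*-mono-≤ (s≤s r≤s) (s≤s r≤s)) (triangle-mono (s≤s r≤s))
    where
    triangle-mono : ∀ {r s} → r ≤ s → triangle r ≤ triangle s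
    triangle-mono z≤n       = z≤n
    triangle-mono (s≤s r≤s) = +-mono-≤ (s≤s r≤s) (triangle-mono r≤s)

  pentagonal⁻-mono : ∀ {r s} → r ≤ s → pentagonal⁻ (suc r) ≤ pentagonal⁻ (suc s)
  pentagonal⁻-mono r≤s = +-mono-≤ (s≤s (+-mono-≤ r≤s r≤s)) (pentagonal-mono r≤s)

  triangle-+ : ∀ m n → triangle (m + n) ≡ m * n + triangle m + triangle n
  triangle-+ zero    n = refl
  triangle-+ (suc m) n rewrite triangle-+ m n = eq m n (triangle m) (triangle n)
    where
    eq : ∀ m n s t → suc (m + n) + (m * n + s + t) ≡ (n + m * n) + (suc m + s) + t
    eq = solve-∀

  -- Together with `triangle-≤-exponent` this shows that a `T_j` below `pentagonal⁻ k` has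
  -- `j < 2 k`.
  pentagonal⁻-≤-triangle : ∀ k → pentagonal⁻ k ≤ triangle (k + k)
  pentagonal⁻-≤-triangle zero    = z≤n
  pentagonal⁻-≤-triangle (suc r) =
    subst (pentagonal⁻ (suc r) ≤_) (trans (eq r (triangle r)) (sym (triangle-+ (suc r) (suc r))))
          (m≤m+n _ _)
    where
    eq : ∀ r t → suc (r + r) + (r * r + t) + (suc r + suc r + t) ≡
                 suc r * suc r + (suc r + t) + (suc r + t)
    eq = solve-∀

  pentagonals-≤ : ∀ r → All (_≤ pentagonal r) (pentagonals r)
  pentagonals-≤ zero    = z≤n ∷ []
  pentagonals-≤ (suc r) = ≤-refl ∷ pentagonal⁻-≤ (suc r) ∷
    All.map (λ d≤ → ≤-trans d≤ (pentagonal-mono (n≤1+n r))) (pentagonals-≤ r)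

  length-pentagonals : ∀ r → length (pentagonals r) ≡ suc (r + r)
  length-pentagonals zero    = refl
  length-pentagonals (suc r) =
    cong (λ l → suc (suc l)) (trans (length-pentagonals r) (sym (+-suc r r)))

  pentagonals-⊆ : ∀ {r s d} → r ≤ s → d ∈ pentagonals r → d ∈ pentagonals s
  pentagonals-⊆ {s = zero}  z≤n d∈ = d∈
  pentagonals-⊆ {s = suc s} r≤  d∈ with m≤n⇒m<n∨m≡n r≤
  ... | inj₁ (s≤s r≤s) = there (there (pentagonals-⊆ r≤s d∈))
  ... | inj₂ refl      = d∈

  -- The further exponents exceed `n`. Euler's recurrence asks for an index of at least `n`, while
  -- the parity argument needs exactly the pentagonal numbers up to `n`.
  pentagonals-stable : ∀ {r n} e f → n < pentagonal⁻ (suc r) →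
    applyExponents (pentagonals (e + r)) f n ≡ applyExponents (pentagonals r) f n
  pentagonals-stable         zero    f n< = refl
  pentagonals-stable {r} {n} (suc e) f n< =
    trans (cong₂ ℙ._+_ (shift-< f (<-≤-trans n<⁻ (pentagonal⁻-≤ (suc (e + r)))))
            (cong (ℙ._+ applyExponents (pentagonals (e + r)) f n) (shift-< f n<⁻)))
          (pentagonals-stable e f n<)
    where
    n<⁻ : n < pentagonal⁻ (suc (e + r))
    n<⁻ = <-≤-trans n< (pentagonal⁻-mono (m≤n+m r e))

  -- If all summands were odd, the sum would have the parity of their number, which is odd.
  even-summand : ∀ ds (f : Series) n → All (_≤ n) ds → parity (length ds) ≡ 1ℙ →
    applyExponents ds f n ≡ 0ℙ → ∃[ d ] d ∈ ds × f (n ∸ d) ≡ 0ℙ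
  even-summand ds f n ≤n odd sum≡0 with any? (λ d → f (n ∸ d) ℙ.≟ 0ℙ) ds
  ... | yes e = find e
  ... | no ¬e = contradiction (trans (sym sum≡0) (trans (all-odd ≤n ¬e) odd)) λ ()
    where
    all-odd : ∀ {ds} → All (_≤ n) ds → ¬ Any.Any (λ d → f (n ∸ d) ≡ 0ℙ) ds →
              applyExponents ds f n ≡ parity (length ds)
    all-odd {[]}     []         _  = refl
    all-odd {d ∷ ds} (d≤n ∷ ps) ¬e =
      trans (cong₂ ℙ._+_ (trans (shift-∸ f d≤n) (≢0 (λ e → ¬e (here e)))) (all-odd ps (λ e → ¬e (there e))))
            (sym (parity-suc (length ds)))
      where
      ≢0 : ∀ {q} → q ≢ 0ℙ → q ≡ 1ℙ
      ≢0 {0ℙ} q≢0 = contradiction refl q≢0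
      ≢0 {1ℙ} _   = refl

  parity-odd : ∀ r → parity (suc (r + r)) ≡ 1ℙ
  parity-odd r = trans (parity-suc (r + r)) (cong (1ℙ ℙ.+_) (trans (ℙ.+-homo-+ r r) (ℙ.p+p≡0ℙ (parity r))))

  -- The n < pentagonal⁻ K with an odd number of pentagonal numbers d ≤ n.
  zones : ℕ → List ℕ
  zones zero    = []
  zones (suc r) = map (pentagonal r +_) (upTo (suc (r + r))) ++ zones r

  length-zones : ∀ k → length (zones k) ≡ k * k
  length-zones zero    = refl
  length-zones (suc r) = begin
    length (map (pentagonal r +_) (upTo (suc (r + r))) ++ zones r)
      ≡⟨ length-++ (map (pentagonal r +_) (upTo (suc (r + r)))) ⟩
    length (map (pentagonal r +_) (upTo (suc (r + r)))) + length (zones r)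
      ≡⟨ cong₂ _+_ (trans (length-map (pentagonal r +_) (upTo (suc (r + r)))) (length-upTo (suc (r + r))))
                   (length-zones r) ⟩
    suc (r + r) + r * r
      ≡⟨ eq r ⟩
    suc r * suc r ∎
    where
    open ≡-Reasoning
    eq : ∀ r → suc (r + r) + r * r ≡ suc r * suc r
    eq = solve-∀

  ∈-zones⁻ : ∀ k {n} → n ∈ zones k →
             ∃[ r ] r < k × pentagonal r ≤ n × n < pentagonal⁻ (suc r)
  ∈-zones⁻ (suc r) n∈ with ∈-++⁻ (map (pentagonal r +_) (upTo (suc (r + r)))) n∈
  ... | inj₂ n∈zones with s , s<r , bounds ← ∈-zones⁻ r n∈zones = s , m≤n⇒m≤1+n s<r , bounds
  ... | inj₁ n∈block with i , i∈ , refl ← ∈-map⁻ (pentagonal r +_) n∈block =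
    r , ≤-refl , m≤m+n (pentagonal r) i ,
    subst (pentagonal r + i <_) (+-comm (pentagonal r) (suc (r + r)))
          (+-monoʳ-< (pentagonal r) (∈-upTo⁻ i∈))

  zones-unique : ∀ k → Unique (zones k)
  zones-unique zero    = []
  zones-unique (suc r) =
    ++⁺ (map⁺ (λ {i} {j} → +-cancelˡ-≡ (pentagonal r) i j) (upTo⁺ (suc (r + r)))) (zones-unique r) disjoint
    where
    disjoint : ∀ {n} → n ∈ map (pentagonal r +_) (upTo (suc (r + r))) × n ∈ zones r → _
    disjoint (n∈block , n∈zones)
      with i , _ , refl ← ∈-map⁻ (pentagonal r +_) n∈block | s , s<r , _ , n< ← ∈-zones⁻ r n∈zones =
      -- The earlier block ends below `pentagonal⁻ (suc s) ≤ pentagonal r`, where the new block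
      -- begins.
      <⇒≱ n< (≤-trans (pentagonal⁻-≤ (suc s)) (≤-trans (pentagonal-mono s<r) (m≤m+n (pentagonal r) i)))

  length-cartesianProductWith : ∀ (f : ℕ → ℕ → ℕ) xs ys →
    length (cartesianProductWith f xs ys) ≡ length xs * length ys
  length-cartesianProductWith f []       ys = refl
  length-cartesianProductWith f (x ∷ xs) ys =
    trans (length-++ (map (f x) ys)) (cong₂ _+_ (length-map (f x) ys) (length-cartesianProductWith f xs ys))

  module _ (A a : ℕ) .{{_ : NonZero A}} .{{_ : NonZero a}} (a≤A : a ≤ A) where

    evens : ℕ → List ℕ
    evens N = filter (λ n → p A a n ≡? 0 [mod 2 ]) (applyUpTo suc N)

    ∈-evens : ∀ {N m} → 0 < m → m ≤ N → parity (p A a m) ≡ 0ℙ → m ∈ evens N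
    ∈-evens {N} {suc i} _ i<N even = ∈-filter⁺ (λ n → p A a n ≡? 0 [mod 2 ]) (∈-applyUpTo⁺ suc i<N)
      (subst (2 ∣_) (sym (∣-∣-identityʳ (p A a (suc i)))) (parity≡0⇒2∣ (p A a (suc i)) even))

    -- `evens` starts at `1`, so the argument `0` has to be excluded: there only `T_0 = 0`
    -- contributes, and the single empty partition makes the value odd.
    even⇒positive : ∀ {n} → parity (p A a n) ≡ 0ℙ → 0 < n
    even⇒positive {zero}  even =
      contradiction (trans (sym even) (pSeries-numPartitions A a a≤A {0} {1} (s≤s z≤n))) λ ()
    even⇒positive {suc n} even = s≤s z≤n

    triangle-≤-exponent : ∀ k → triangle k ≤ sum (initial A a a≤A k)
    triangle-≤-exponent zero    = z≤n
    triangle-≤-exponent (suc k) =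
      +-mono-≤ (+-mono-≤ (>-nonZero⁻¹ a) (m≤m*n k A)) (triangle-≤-exponent k)

    exponent-mono : ∀ {j k} → j ≤ k → sum (initial A a a≤A j) ≤ sum (initial A a a≤A k)
    exponent-mono {k = zero}  z≤n = z≤n
    exponent-mono {k = suc k} j≤k with m≤n⇒m<n∨m≡n j≤k
    ... | inj₁ (s≤s j≤k′) = ≤-trans (exponent-mono j≤k′) (m≤n+m _ _)
    ... | inj₂ refl       = ≤-refl

    -- A zone element `n` that is no `T_k` makes the recurrence vanish with an odd number of
    -- summands. One of them is then even, and `n` is a pentagonal number plus the argument of that
    -- even value.
    zones-⊆ : ∀ r {N n} → pentagonal⁻ (suc r) ≤ suc N → n ∈ zones (suc r) →
      n ∈ exponents A a a≤A (suc r + suc r) ++ cartesianProductWith _+_ (pentagonals r) (evens N)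
    zones-⊆ r {N} {n} bound n∈ with ∈-zones⁻ (suc r) n∈
    ... | s , s≤s s≤r , s≤n , n<s with n ∈? exponents A a a≤A (suc n)
    ... | yes n∈exp with k , _ , refl ← ∈-map⁻ (λ k → sum (initial A a a≤A k)) {xs = downFrom (suc n)} n∈exp =
      -- If `k` were at least `2 (r + 1)`, then `n = T_k` would be at least `pentagonal⁻ (suc r)`.
      ∈-++⁺ˡ {xs = exponents A a a≤A (suc r + suc r)} (∈-map⁺ (λ k → sum (initial A a a≤A k)) (∈-downFrom⁺ {suc r + suc r} {k} (≰⇒> λ k≥ →
        <⇒≱ (<-≤-trans n<s (≤-trans (pentagonal⁻-mono s≤r) (pentagonal⁻-≤-triangle (suc r))))
            (≤-trans (triangle-≤-exponent (suc r + suc r)) (exponent-mono {suc r + suc r} {k} k≥)))))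
    ... | no n∉exp with even-summand (pentagonals s) (pSeries A a a≤A) n
                          (All.map (λ d≤ → ≤-trans d≤ s≤n) (pentagonals-≤ s))
                          (trans (cong parity (length-pentagonals s)) (parity-odd s))
                          -- The recurrence is taken at the index `n + s`, which is at least `n`,
                          -- and then cut back to `s`.
                          (trans (sym (pentagonals-stable n (pSeries A a a≤A) n<s))
                                 (pentagonals-pSeries A a a≤A {K = suc n} (m≤m+n n s) ≤-refl n∉exp))
    ... | d , d∈ , even = ∈-++⁺ʳ (exponents A a a≤A (suc r + suc r))
      (subst (_∈ cartesianProductWith _+_ (pentagonals r) (evens N)) (m+[n∸m]≡n d≤n)
        (∈-cartesianProductWith⁺ _+_ (pentagonals-⊆ s≤r d∈) (∈-evens (even⇒positive even) ≤N even)))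
      where
      d≤n : d ≤ n
      d≤n = ≤-trans (All.lookup (pentagonals-≤ s) d∈) s≤n
      ≤N : n ∸ d ≤ N
      ≤N = ≤-trans (m∸n≤m n d) (≤-pred (<-≤-trans n<s (≤-trans (pentagonal⁻-mono s≤r) bound)))

    -- With `E` even values, comparing lengths in `zones-⊆` gives `k * k ≤ 2 k + (2 k - 1) E` for
    -- positive `k`.
    evens-bound : ∀ {k N} → pentagonal⁻ k ≤ suc N → k ≤ 2 * suc (length (evens N))
    evens-bound {zero}      _     = z≤n
    evens-bound {suc r} {N} bound = *-cancelˡ-≤ (suc r) (begin
      suc r * suc r
        ≡⟨ sym (length-zones (suc r)) ⟩
      length (zones (suc r))
        ≤⟨ length-≤-relation {R = _≡_} (zones-unique (suc r))
             (λ n∈ → _ , zones-⊆ r bound n∈ , refl) (λ _ _ p q → trans p (sym q)) ⟩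
      length (exponents A a a≤A (suc r + suc r) ++ cartesianProductWith _+_ (pentagonals r) (evens N))
        ≡⟨ trans (length-++ (exponents A a a≤A (suc r + suc r))) (cong₂ _+_
             (trans (length-map _ (downFrom (suc r + suc r))) (length-downFrom (suc r + suc r)))
             (trans (length-cartesianProductWith _+_ (pentagonals r) (evens N))
                    (cong (_* length (evens N)) (length-pentagonals r)))) ⟩
      suc r + suc r + suc (r + r) * length (evens N)
        -- Rounding the factor `2 r + 1` up to `2 (r + 1)` makes `suc r` a common factor that
        -- cancels.
        ≤⟨ +-monoʳ-≤ (suc r + suc r) (*-monoˡ-≤ (length (evens N)) (+-monoʳ-≤ 1 (+-monoʳ-≤ r (n≤1+n r)))) ⟩
      suc r + suc r + (suc r + suc r) * length (evens N)
        ≡⟨ eq r (length (evens N)) ⟩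
      suc r * (2 * suc (length (evens N))) ∎)
      where
      open ≤-Reasoning
      eq : ∀ r e → suc r + suc r + (suc r + suc r) * e ≡ suc r * (2 * suc e)
      eq = solve-∀

-- The square-root bound over the rationals.

module Rationals where
  open Series using (triangle; pentagonal⁻)
  open EvenValues using (evens-bound; evens)
  open import Data.Nat.Base as ℕ using (ℕ; zero; suc; z≤n; s≤s)
  import Data.Nat.Properties as ℕ
  import Data.Nat.DivMod as ℕ
  open import Data.Nat.Tactic.RingSolver using (solve-∀)
  open import Data.Integer.Base as ℤ using (+_; -[1+_]; 0ℤ)
  import Data.Integer.Properties as ℤ
  open import Data.Rational.Base
  open import Data.Rational.Properties
  open import Data.List.Base using (length)
  open import Data.Nat.Coprimality as Coprime using (Coprime)
  open import Data.Sum.Base using (inj₁; inj₂)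
  open import Relation.Binary.PropositionalEquality

  -- On this normal form with denominator `1`, products and comparisons of rationals unfold to
  -- integers.
  fromℕ-mkℚ : ∀ n → fromℕ n ≡ mkℚ (+ n) 0 (Coprime.sym (Coprime.1-coprimeTo n))
  fromℕ-mkℚ n = normalize-coprime (Coprime.sym (Coprime.1-coprimeTo n))

  fromℕ-* : ∀ m n → fromℕ m * fromℕ n ≡ fromℕ (m ℕ.* n)
  fromℕ-* m n rewrite fromℕ-mkℚ m | fromℕ-mkℚ n = cong (_/ 1) (sym (ℤ.pos-* m n))

  fromℕ-mono-≤ : ∀ {m n} → m ℕ.≤ n → fromℕ m ≤ fromℕ n
  fromℕ-mono-≤ {m} {n} m≤n rewrite fromℕ-mkℚ m | fromℕ-mkℚ n =
    *≤* (ℤ.*-monoʳ-≤-nonNeg (+ 1) (ℤ.+≤+ m≤n))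

  fromℕ-nonNeg : ∀ n → 0ℚ ≤ fromℕ n
  fromℕ-nonNeg n = fromℕ-mono-≤ {0} {n} z≤n

  -- The floor is cut off at `0` just as in `evenCount`, so `evenCount A a X` is by definition the
  -- length of `evens` at `natPart X`.
  natPart : ℚ → ℕ
  natPart q = ℤ.∣ floor q ℤ.⊔ 0ℤ ∣

  natPart-mkℚ : ∀ x d-1 .(c : Coprime x (suc d-1)) → natPart (mkℚ (+ x) d-1 c) ≡ x ℕ./ suc d-1
  natPart-mkℚ x d-1 c =
    trans (cong (λ i → ℤ.∣ i ℤ.⊔ 0ℤ ∣) (ℤ.*-identityˡ (+ (x ℕ./ suc d-1)))) (ℕ.⊔-identityʳ _)

  natPart-≤ : ∀ q → 0ℚ ≤ q → fromℕ (natPart q) ≤ q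
  natPart-≤ (mkℚ -[1+ _ ] _ _) (*≤* ())
  natPart-≤ (mkℚ (+ x) d-1 c)  _
    rewrite natPart-mkℚ x d-1 c | fromℕ-mkℚ (x ℕ./ suc d-1) =
    *≤* (subst₂ ℤ._≤_ (ℤ.pos-* (x ℕ./ suc d-1) (suc d-1)) (sym (ℤ.*-identityʳ (+ x)))
          (ℤ.+≤+ (ℕ.m/n*n≤m x (suc d-1))))

  ≤-natPart+1 : ∀ q → 0ℚ ≤ q → q ≤ fromℕ (suc (natPart q))
  ≤-natPart+1 (mkℚ -[1+ _ ] _ _) (*≤* ())
  ≤-natPart+1 (mkℚ (+ x) d-1 c)  _
    rewrite natPart-mkℚ x d-1 c | fromℕ-mkℚ (suc (x ℕ./ suc d-1)) =
    *≤* (subst₂ ℤ._≤_ (sym (ℤ.*-identityʳ (+ x))) (ℤ.pos-* (suc (x ℕ./ suc d-1)) (suc d-1))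
          (ℤ.+≤+ x≤))
    where
    x≤ : x ℕ.≤ suc (x ℕ./ suc d-1) ℕ.* suc d-1
    x≤ = subst (ℕ._≤ suc (x ℕ./ suc d-1) ℕ.* suc d-1) (sym (ℕ.m≡m%n+[m/n]*n x (suc d-1)))
           (ℕ.+-monoˡ-≤ (x ℕ./ suc d-1 ℕ.* suc d-1) (ℕ.m%n≤n x (suc d-1)))

  natPart-max : ∀ {n} q → 0ℚ ≤ q → fromℕ n ≤ q → n ℕ.≤ natPart q
  natPart-max     (mkℚ -[1+ _ ] _ _) (*≤* ())
  natPart-max {n} (mkℚ (+ x) d-1 c)  _ n≤q rewrite fromℕ-mkℚ n | natPart-mkℚ x d-1 c with *≤* h ← n≤q =
    subst (ℕ._≤ x ℕ./ suc d-1) (ℕ.m*n/n≡m n (suc d-1)) (ℕ./-monoˡ-≤ (suc d-1)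
      (ℤ.drop‿+≤+ (subst₂ ℤ._≤_ (sym (ℤ.pos-* n (suc d-1))) (ℤ.*-identityʳ (+ x)) h)))

  triangle-≤-square : ∀ k → triangle k ℕ.≤ k ℕ.* k
  triangle-≤-square zero    = z≤n
  triangle-≤-square (suc k) =
    ℕ.+-monoʳ-≤ (suc k) (ℕ.≤-trans (triangle-≤-square k) (ℕ.*-monoʳ-≤ k (ℕ.n≤1+n k)))

  -- A crude bound, as the growth is only about `3 k² / 2`; the factor `3` matches the `3 s² ≤ X`
  -- that `s² ≤ X / 3` provides.
  pentagonal⁻-≤-3square : ∀ k → pentagonal⁻ k ℕ.≤ 3 ℕ.* (k ℕ.* k)
  pentagonal⁻-≤-3square zero    = z≤n
  pentagonal⁻-≤-3square (suc r) = begin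
    suc (r ℕ.+ r) ℕ.+ (r ℕ.* r ℕ.+ triangle r)
      ≤⟨ ℕ.+-monoʳ-≤ (suc (r ℕ.+ r)) (ℕ.+-monoʳ-≤ (r ℕ.* r) (triangle-≤-square r)) ⟩
    suc (r ℕ.+ r) ℕ.+ (r ℕ.* r ℕ.+ r ℕ.* r)
      ≤⟨ ℕ.m≤m+n _ _ ⟩
    suc (r ℕ.+ r) ℕ.+ (r ℕ.* r ℕ.+ r ℕ.* r) ℕ.+ (2 ℕ.+ 4 ℕ.* r ℕ.+ r ℕ.* r)
      ≡⟨ eq r ⟩
    3 ℕ.* (suc r ℕ.* suc r) ∎
    where
    open ℕ.≤-Reasoning
    eq : ∀ r → suc (r ℕ.+ r) ℕ.+ (r ℕ.* r ℕ.+ r ℕ.* r) ℕ.+ (2 ℕ.+ 4 ℕ.* r ℕ.+ r ℕ.* r) ≡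
               3 ℕ.* (suc r ℕ.* suc r)
    eq = solve-∀

  module _ (A a : ℕ) .{{_ : ℕ.NonZero A}} .{{_ : ℕ.NonZero a}} (a≤A : a ℕ.≤ A) where

    -- `evens-bound` gives `3 k - 6 ≤ 6 E`, and `3 k - 6` is at least `k + 1` once `6 ≤ k`. The
    -- successor absorbs the rounding of `s` in `evenCount-√`.
    evens-sixth : ∀ {k N} → 6 ℕ.≤ k → 3 ℕ.* (k ℕ.* k) ℕ.≤ N →
                  suc k ℕ.≤ 6 ℕ.* length (evens A a a≤A N)
    evens-sixth {k} {N} 6≤k 3k²≤N = ℕ.+-cancelʳ-≤ (suc k ℕ.+ 6) (suc k) (6 ℕ.* E) (begin
      suc k ℕ.+ (suc k ℕ.+ 6)
        ≤⟨ ℕ.+-monoʳ-≤ (suc k) (ℕ.+-monoʳ-≤ (suc k) 6≤k) ⟩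
      suc k ℕ.+ (suc k ℕ.+ k)
        ≡⟨ eq₁ k ⟩
      2 ℕ.+ 3 ℕ.* k
        ≤⟨ ℕ.+-monoʳ-≤ 2 (ℕ.*-monoʳ-≤ 3 (evens-bound A a a≤A {k} {N}
             (ℕ.≤-trans (pentagonal⁻-≤-3square k) (ℕ.m≤n⇒m≤1+n 3k²≤N)))) ⟩
      2 ℕ.+ 3 ℕ.* (2 ℕ.* suc E)
        ≡⟨ eq₂ E ⟩
      6 ℕ.* E ℕ.+ (2 ℕ.+ 6)
        ≤⟨ ℕ.+-monoʳ-≤ (6 ℕ.* E) (ℕ.+-monoˡ-≤ 6 (s≤s (ℕ.≤-trans (s≤s z≤n) 6≤k))) ⟩
      6 ℕ.* E ℕ.+ (suc k ℕ.+ 6) ∎)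
      where
      open ℕ.≤-Reasoning
      E = length (evens A a a≤A N)
      eq₁ : ∀ k → suc k ℕ.+ (suc k ℕ.+ k) ≡ 2 ℕ.+ 3 ℕ.* k
      eq₁ = solve-∀
      eq₂ : ∀ e → 2 ℕ.+ 3 ℕ.* (2 ℕ.* suc e) ≡ 6 ℕ.* e ℕ.+ (2 ℕ.+ 6)
      eq₂ = solve-∀

    -- With `j` the floor of `s`, `k` the maximum of `j` and `6`, and `E` the count,
    -- `s ≤ j + 1 ≤ k + 1 ≤ 6 E`.
    evenCount-√ : ∀ X → fromℕ 108 ≤ X → (+ 1 / 6) *√ (X ÷ (+ 3 / 1)) ≤ fromℕ (evenCount A a X)
    evenCount-√ X 108≤X s 0≤s s²≤ = begin
      (+ 1 / 6) * s
        ≤⟨ *-monoˡ-≤-nonNeg (+ 1 / 6) (≤-trans (≤-natPart+1 s 0≤s)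
             (≤-trans (fromℕ-mono-≤ (s≤s (ℕ.m≤m⊔n j 6)))
               (fromℕ-mono-≤ (evens-sixth (ℕ.m≤n⊔m j 6) 3k²≤N)))) ⟩
      (+ 1 / 6) * fromℕ (6 ℕ.* evenCount A a X)
        ≡⟨ cong ((+ 1 / 6) *_) (sym (fromℕ-* 6 (evenCount A a X))) ⟩
      (+ 1 / 6) * (fromℕ 6 * fromℕ (evenCount A a X))
        ≡⟨ sym (*-assoc (+ 1 / 6) (fromℕ 6) (fromℕ (evenCount A a X))) ⟩
      1ℚ * fromℕ (evenCount A a X)
        ≡⟨ *-identityˡ (fromℕ (evenCount A a X)) ⟩
      fromℕ (evenCount A a X) ∎
      where
      open ≤-Reasoning
      0≤X : 0ℚ ≤ X
      0≤X = ≤-trans (fromℕ-nonNeg 108) 108≤X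

      j = natPart s

      j²≤s² : fromℕ (j ℕ.* j) ≤ s * s
      j²≤s² = begin
        fromℕ (j ℕ.* j)   ≡⟨ sym (fromℕ-* j j) ⟩
        fromℕ j * fromℕ j ≤⟨ *-monoˡ-≤-nonNeg (fromℕ j) {{nonNegative (fromℕ-nonNeg j)}} (natPart-≤ s 0≤s) ⟩
        fromℕ j * s       ≤⟨ *-monoʳ-≤-nonNeg s {{nonNegative 0≤s}} (natPart-≤ s 0≤s) ⟩
        s * s             ∎

      3j²≤X : fromℕ (3 ℕ.* (j ℕ.* j)) ≤ X
      3j²≤X = begin
        fromℕ (3 ℕ.* (j ℕ.* j))         ≡⟨ sym (fromℕ-* 3 (j ℕ.* j)) ⟩
        fromℕ 3 * fromℕ (j ℕ.* j)       ≤⟨ *-monoˡ-≤-nonNeg (fromℕ 3) (≤-trans j²≤s² s²≤) ⟩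
        fromℕ 3 * (X * (1/ (+ 3 / 1)))  ≡⟨ *-comm (fromℕ 3) (X * (1/ (+ 3 / 1))) ⟩
        X * (1/ (+ 3 / 1)) * fromℕ 3    ≡⟨ *-assoc X (1/ (+ 3 / 1)) (fromℕ 3) ⟩
        X * 1ℚ                          ≡⟨ *-identityʳ X ⟩
        X                               ∎

      -- For small `s` the maximum is `6`, and `3 * (6 * 6) = 108` is the threshold on `X`.
      3k²≤N : 3 ℕ.* ((j ℕ.⊔ 6) ℕ.* (j ℕ.⊔ 6)) ℕ.≤ natPart X
      3k²≤N with ℕ.⊔-sel j 6
      ... | inj₁ e rewrite e = natPart-max X 0≤X 3j²≤X
      ... | inj₂ e rewrite e = natPart-max X 0≤X 108≤X

-- Explicit constants for `A = m * t` and `a = t`.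

open import Data.Nat.Base using (ℕ; NonZero; _*_)
open import Data.Integer.Base using (+_)
open import Data.Rational.Base using (ℚ; 0ℚ; _<_; _≤_; _/_; _÷_)
open import Data.Product.Base using (_×_; _,_; ∃-syntax)
open import Data.Nat.Properties using (m≤n*m; m*n≢0)
open import Data.Rational.Properties using (positive⁻¹)

theorem1p1 : (t m : ℕ) .{{_ : NonZero t}} .{{_ : NonZero m}} →
    ∃[ c ] ∃[ X₀ ] (0ℚ < c × ((X : ℚ) → X₀ ≤ X →
    c *√ (X ÷ (+ 3 / 1)) ≤ fromℕ (evenCount (m * t) t X)))
theorem1p1 t m =
  -- Neither constant depends on `m` or `t`.
  + 1 / 6 , fromℕ 108 , positive⁻¹ (+ 1 / 6) ,
  Rationals.evenCount-√ (m * t) t {{m*n≢0 m t}} (m≤n*m t m)
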